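{- Let $k \in \mathbb{N}$, let $m_1,m_2$ be integers with $1 \leq m_1 \leq m_2$, and let $\rho = \lceil (m_1+m_2+2)/k \rceil$. If $m_2 \leq \rho(k-1)-1$ and $m_1+m_2 \leq 15 + \rho(k-2)$, then the disjoint union $K_{1,m_1} + K_{1,m_2}$ is equitably $k$-choosable.
   Context: All graphs are finite and simple; $\mathbb{N}=\{1,2,3,\dots\}$. A list assignment $L$ for a graph $G$ assigns to each vertex $v$ a set $L(v)$ of colors; it is a $k$-assignment if $|L(v)|=k$ for all $v$. The palette of $L$ is $\bigcup_{v} L(v)$. A proper $L$-coloring is a proper coloring $f$ with $f(v)\in L(v)$ for all $v$. If $L$ is a $k$-assignment, an equitable $L$-coloring of $G$ is a proper $L$-coloring in which each color of the palette appears on at most $\lceil |V(G)|/k \rceil$ vertices. $G$ is equitably $k$-choosable if an equitable $L$-coloring exists for every $k$-assignment $L$ for $G$. -}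

module Defs where

open import Data.Nat using (ℕ; zero; suc; _+_; _∸_; _≤_; _/_; NonZero)
open import Data.Nat.Properties using (_≟_)
open import Data.Fin using (Fin; splitAt) renaming (zero to fzero)
open import Data.Sum using (_⊎_; inj₁; inj₂)
open import Data.Product using (_×_; Σ; _,_)
open import Data.Empty using (⊥)
open import Data.List using (List; length; filter; concatMap)
open import Data.List.Relation.Unary.Unique.Propositional using (Unique)
open import Data.List.Membership.Propositional using (_∈_)
open import Data.Fin.Base using () 
open import Data.List using (allFin)
open import Relation.Nullary using (¬_)
open import Relation.Binary.PropositionalEquality using (_≡_)

⌈_/_⌉ : ℕ → (k : ℕ) → .{{NonZero k}} → ℕ
⌈ a / k ⌉ = (a + (k ∸ 1)) / k

record Graph (n : ℕ) : Set₁ where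
  field
    Adj     : Fin n → Fin n → Set
    symAdj  : ∀ {u v} → Adj u v → Adj v u
    irrAdj  : ∀ {v} → ¬ Adj v v
open Graph public

ListAssignment : ℕ → Set
ListAssignment n = Fin n → List ℕ

IsKAssignment : ∀ {n} → ℕ → ListAssignment n → Set
IsKAssignment {n} k L = ∀ (v : Fin n) → Unique (L v) × length (L v) ≡ k

palette : ∀ {n} → ListAssignment n → List ℕ
palette {n} L = concatMap L (allFin n)

colorCount : ∀ {n} → (Fin n → ℕ) → ℕ → ℕ
colorCount {n} f c = length (filter (λ v → f v ≟ c) (allFin n))

IsProperLColoring : ∀ {n} → Graph n → ListAssignment n → (Fin n → ℕ) → Set
IsProperLColoring G L f =
  (∀ v → f v ∈ L v) × (∀ u v → Adj G u v → ¬ f u ≡ f v)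

IsEquitableLColoring : ∀ {n} → Graph n → (k : ℕ) → .{{NonZero k}} →
                       ListAssignment n → (Fin n → ℕ) → Set
IsEquitableLColoring {n} G k L f =
  IsProperLColoring G L f × (∀ c → c ∈ palette L → colorCount f c ≤ ⌈ n / k ⌉)

EquitablyChoosable : ∀ {n} → Graph n → (k : ℕ) → .{{NonZero k}} → Set
EquitablyChoosable {n} G k =
  ∀ (L : ListAssignment n) → IsKAssignment k L →
    Σ (Fin n → ℕ) (λ f → IsEquitableLColoring G k L f)

StarAdj : ∀ {p} → Fin (suc p) → Fin (suc p) → Set
StarAdj a b = (a ≡ fzero × ¬ b ≡ fzero) ⊎ (b ≡ fzero × ¬ a ≡ fzero)

UnionAdj : (m₁ m₂ : ℕ) → Fin (suc m₁ + suc m₂) → Fin (suc m₁ + suc m₂) → Set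
UnionAdj m₁ m₂ u v with splitAt (suc m₁) u | splitAt (suc m₁) v
... | inj₁ a | inj₁ b = StarAdj a b
... | inj₂ a | inj₂ b = StarAdj a b
... | inj₁ _ | inj₂ _ = ⊥
... | inj₂ _ | inj₁ _ = ⊥

private
  starSym : ∀ {p} {a b : Fin (suc p)} → StarAdj a b → StarAdj b a
  starSym (inj₁ x) = inj₂ x
  starSym (inj₂ x) = inj₁ x

  starIrr : ∀ {p} {a : Fin (suc p)} → ¬ StarAdj a a
  starIrr (inj₁ (e , ne)) = ne e
  starIrr (inj₂ (e , ne)) = ne e

unionSym : ∀ m₁ m₂ {u v} → UnionAdj m₁ m₂ u v → UnionAdj m₁ m₂ v u
unionSym m₁ m₂ {u} {v} h with splitAt (suc m₁) u | splitAt (suc m₁) v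
... | inj₁ a | inj₁ b = starSym h
... | inj₂ a | inj₂ b = starSym h

unionIrr : ∀ m₁ m₂ {v} → ¬ UnionAdj m₁ m₂ v v
unionIrr m₁ m₂ {v} h with splitAt (suc m₁) v
... | inj₁ a = starIrr h
... | inj₂ a = starIrr h

TwoStars : (m₁ m₂ : ℕ) → Graph (suc m₁ + suc m₂)
TwoStars m₁ m₂ = record
  { Adj = UnionAdj m₁ m₂ ; symAdj = λ {u} {v} → unionSym m₁ m₂ {u} {v} ; irrAdj = λ {v} → unionIrr m₁ m₂ {v} }

≢0-of : ∀ {k} → 1 ≤ k → NonZero k
≢0-of {suc k} _ = _

{-# OPTIONS --safe #-}
-- Fix colours x and y of the two centres. By a capacitated form of Hall's theorem the colouring
-- extends to the leaves unless, for some set U of k - 1 colours containing neither x nor y, more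
-- than ρ(k - 1) leaves have their list equal to U ∪ {x} (first star) or U ∪ {y} (second
-- star). Two such obstructions share the hull U ∪ {x} or the hull U ∪ {y}, since otherwise there would be
-- too many leaves. Try two colours for each centre. If all four attempts are obstructed, then all
-- four obstructions share one and the same hull on one side, and have four distinct hulls on the
-- other, each of them the list of at least two leaves. That makes m₁ + m₂ ≥ ρ(k - 1) + 7, while
-- averaging m₁ + m₂ ≤ ρk - 2 and m₁ + m₂ ≤ 15 + ρ(k - 2) gives m₁ + m₂ ≤ ρ(k - 1) + 6.
module Submission where

open import Defs
open import Data.Nat using (ℕ; suc; _+_; _*_; _∸_; _≤_; _<_)

open import Data.Bool using (if_then_else_)
import Data.Bool.Properties as Bool
open import Data.Empty using () renaming (⊥ to Empty)
open import Data.Fin using (Fin; zero; suc; toℕ; fromℕ<; splitAt; join)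
import Data.Fin as Fin
open import Data.Fin.Properties using (any?; toℕ-injective; toℕ-fromℕ<; join-splitAt)
open import Data.Fin.Subset using (Subset; _∈_; _∉_; _⊆_; _∪_; _∩_; _-_; ⁅_⁆; ⊥; ∣_∣; inside; outside)
open import Data.Fin.Subset.Properties
open import Data.List using (List; []; _∷_; length; filter; tabulate; allFin; map)
open import Data.List.Extrema.Nat using (max; xs≤max)
import Data.List.Membership.DecPropositional as DecMembership
import Data.List.Membership.Propositional as List
open import Data.List.Membership.Propositional.Properties using (∈-allFin; ∈-concatMap⁺)
open import Data.List.Relation.Unary.All as All using (All; []; _∷_)
open import Data.List.Relation.Unary.AllPairs using ([]; _∷_)
open import Data.List.Relation.Unary.Any as Any using (Any; here; there)
open import Data.List.Relation.Unary.Unique.Propositional using (Unique)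
open import Data.Nat using (pred; zero; z≤n; s≤s; _≤?_)
open import Data.Nat.DivMod using (m≡m%n+[m/n]*n; m%n<n; _%_)
open import Data.Nat.ListAction using (sum)
open import Data.Nat.Properties
open import Data.Nat.Tactic.RingSolver using (solve-∀)
open import Data.Product using (Σ; ∃; ∃₂; _×_; _,_; proj₁; proj₂)
open import Data.Sum using (_⊎_; inj₁; inj₂; [_,_]′)
import Data.Sum as Sum
open import Data.Vec as Vec using (Vec; []; _∷_; lookup; replicate; _[_]%=_; here; there)
open import Data.Vec.Properties
  using (≡-dec; lookup⇒[]=; []=⇒lookup; lookup∘tabulate; lookup∘updateAt; lookup∘updateAt′; lookup-replicate)
open import Function using (_∘_; id)
open import Relation.Binary.PropositionalEquality
open import Relation.Nullary using (¬_; Dec; yes; no; does; contradiction)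
open import Relation.Nullary.Decidable using (dec-true)

open DecMembership _≟_ using () renaming (_∈?_ to _∈ˡ?_)

private
  variable
    m n w κ : ℕ

-- Counting

indicator : {P : Set} → Dec P → ℕ
indicator P? = if does P? then 1 else 0

count : {P : Fin m → Set} → (∀ i → Dec (P i)) → ℕ
count {zero}  P? = 0
count {suc m} P? = indicator (P? zero) + count (P? ∘ suc)

indicator≤1 : {P : Set} (P? : Dec P) → indicator P? ≤ 1
indicator≤1 (yes _) = ≤-refl
indicator≤1 (no _)  = z≤n

indicator-mono : {P Q : Set} (P? : Dec P) (Q? : Dec Q) → (P → Q) → indicator P? ≤ indicator Q?
indicator-mono (no _)  _       _   = z≤n
indicator-mono (yes _) (yes _) _   = ≤-refl
indicator-mono (yes p) (no ¬q) P⇒Q = contradiction (P⇒Q p) ¬q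

indicator-submodular : {P Q R T : Set} (P? : Dec P) (Q? : Dec Q) (R? : Dec R) (T? : Dec T) →
  (P ⊎ Q → R) → (P → Q → T) → indicator P? + indicator Q? ≤ indicator R? + indicator T?
indicator-submodular (no _)  Q?      R? _  ⊎⇒R ×⇒T = ≤-trans (indicator-mono Q? R? (⊎⇒R ∘ inj₂)) (m≤m+n _ _)
indicator-submodular (yes p) (no _)  R? T? ⊎⇒R ×⇒T = +-mono-≤ (indicator-mono (yes p) R? (⊎⇒R ∘ inj₁)) z≤n
indicator-submodular (yes p) (yes q) R? T? ⊎⇒R ×⇒T =
  +-mono-≤ (indicator-mono (yes p) R? (⊎⇒R ∘ inj₁)) (indicator-mono (yes q) T? (×⇒T p))

count≤ : {P : Fin m → Set} (P? : ∀ i → Dec (P i)) → count P? ≤ m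
count≤ {zero}  P? = z≤n
count≤ {suc m} P? = +-mono-≤ (indicator≤1 (P? zero)) (count≤ (P? ∘ suc))

count-mono : {P Q : Fin m → Set} (P? : ∀ i → Dec (P i)) (Q? : ∀ i → Dec (Q i)) →
  (∀ i → P i → Q i) → count P? ≤ count Q?
count-mono {zero}  P? Q? P⇒Q = z≤n
count-mono {suc m} P? Q? P⇒Q =
  +-mono-≤ (indicator-mono (P? zero) (Q? zero) (P⇒Q zero)) (count-mono (P? ∘ suc) (Q? ∘ suc) (P⇒Q ∘ suc))

count-none : {P : Fin m → Set} (P? : ∀ i → Dec (P i)) → (∀ i → ¬ P i) → count P? ≡ 0
count-none {zero}  P? ¬P = refl
count-none {suc m} P? ¬P with P? zero
... | yes p = contradiction p (¬P zero)
... | no _  = count-none (P? ∘ suc) (¬P ∘ suc)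

-- `R` need only contain the union and `T` the intersection. The slack matters for `covered`: a set
-- may lie inside `U ∪ V` without lying inside `U` or `V`.
count-submodular : {P Q R T : Fin m → Set}
  (P? : ∀ i → Dec (P i)) (Q? : ∀ i → Dec (Q i)) (R? : ∀ i → Dec (R i)) (T? : ∀ i → Dec (T i)) →
  (∀ i → P i ⊎ Q i → R i) → (∀ i → P i → Q i → T i) → count P? + count Q? ≤ count R? + count T?
count-submodular {zero}  P? Q? R? T? ⊎⇒R ×⇒T = z≤n
count-submodular {suc m} P? Q? R? T? ⊎⇒R ×⇒T = begin
  (p + count (P? ∘ suc)) + (q + count (Q? ∘ suc)) ≡⟨ interchange p _ q _ ⟩
  (p + q) + (count (P? ∘ suc) + count (Q? ∘ suc))
    ≤⟨ +-mono-≤ (indicator-submodular (P? zero) (Q? zero) (R? zero) (T? zero) (⊎⇒R zero) (×⇒T zero))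
                (count-submodular (P? ∘ suc) (Q? ∘ suc) (R? ∘ suc) (T? ∘ suc) (⊎⇒R ∘ suc) (×⇒T ∘ suc)) ⟩
  (r + t) + (count (R? ∘ suc) + count (T? ∘ suc)) ≡⟨ interchange r _ _ _ ⟩
  (r + count (R? ∘ suc)) + (t + count (T? ∘ suc)) ∎
  where
  open ≤-Reasoning
  p q r t : ℕ
  p = indicator (P? zero)
  q = indicator (Q? zero)
  r = indicator (R? zero)
  t = indicator (T? zero)
  interchange : ∀ a b c d → (a + b) + (c + d) ≡ (a + c) + (b + d)
  interchange = solve-∀

count-disjoint : {P Q R : Fin m → Set}
  (P? : ∀ i → Dec (P i)) (Q? : ∀ i → Dec (Q i)) (R? : ∀ i → Dec (R i)) →
  (∀ i → P i ⊎ Q i → R i) → (∀ i → P i → ¬ Q i) → count P? + count Q? ≤ count R?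
count-disjoint P? Q? R? ⊎⇒R P⇒¬Q = begin
  count P? + count Q?                 ≤⟨ count-submodular P? Q? R? never? ⊎⇒R P⇒¬Q ⟩
  count R? + count never?             ≡⟨ cong (count R? +_) (count-none never? (λ _ → id)) ⟩
  count R? + 0                        ≡⟨ +-identityʳ _ ⟩
  count R?                            ∎
  where
  open ≤-Reasoning
  never? : ∀ i → Dec Empty
  never? _ = no id

count-splitAt : ∀ m {n} {P : Fin m ⊎ Fin n → Set} (P? : ∀ s → Dec (P s)) →
  count (P? ∘ splitAt m) ≡ count (P? ∘ inj₁) + count (P? ∘ inj₂)
count-splitAt zero    P? = refl
count-splitAt (suc m) P? = trans
  (cong (indicator (P? (inj₁ zero)) +_) (count-splitAt m (P? ∘ Sum.map suc id)))
  (sym (+-assoc (indicator (P? (inj₁ zero))) _ _))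

length-filter-tabulate : {A : Set} {P : A → Set} (P? : ∀ a → Dec (P a)) (f : Fin m → A) →
  length (filter P? (tabulate f)) ≡ count (P? ∘ f)
length-filter-tabulate {zero}  P? f = refl
length-filter-tabulate {suc m} P? f with P? (f zero)
... | yes _ = cong suc (length-filter-tabulate P? (f ∘ suc))
... | no _  = length-filter-tabulate P? (f ∘ suc)

-- Hall's theorem with capacities

-- Hall's condition compares this total capacity with `covered`, the number of sets that can be
-- served only from within `U`.
weight : Vec ℕ w → Subset w → ℕ
weight []        []            = 0
weight (a ∷ cap) (inside ∷ U)  = a + weight cap U
weight (a ∷ cap) (outside ∷ U) = weight cap U

weight-⊥ : (cap : Vec ℕ w) → weight cap ⊥ ≡ 0
weight-⊥ []        = refl
weight-⊥ (_ ∷ cap) = weight-⊥ cap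

weight-⁅⁆ : (cap : Vec ℕ w) (c : Fin w) → weight cap ⁅ c ⁆ ≡ lookup cap c
weight-⁅⁆ (a ∷ cap) zero    = trans (cong (a +_) (weight-⊥ cap)) (+-identityʳ a)
weight-⁅⁆ (_ ∷ cap) (suc c) = weight-⁅⁆ cap c

weight-replicate : ∀ ρ (U : Subset w) → weight (replicate w ρ) U ≡ ρ * ∣ U ∣
weight-replicate ρ []            = sym (*-zeroʳ ρ)
weight-replicate ρ (inside ∷ U)  = trans (cong (ρ +_) (weight-replicate ρ U)) (sym (*-suc ρ _))
weight-replicate ρ (outside ∷ U) = weight-replicate ρ U

weight-modular : (cap : Vec ℕ w) (U V : Subset w) →
  weight cap (U ∪ V) + weight cap (U ∩ V) ≡ weight cap U + weight cap V
weight-modular [] [] [] = refl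
weight-modular (a ∷ cap) (inside ∷ U) (inside ∷ V) =
  trans (outer a _ _) (trans (cong ((a + a) +_) (weight-modular cap U V)) (sym (outer a _ _)))
  where
  outer : ∀ a x y → (a + x) + (a + y) ≡ (a + a) + (x + y)
  outer = solve-∀
weight-modular (a ∷ cap) (inside ∷ U) (outside ∷ V) =
  trans (+-assoc a _ _) (trans (cong (a +_) (weight-modular cap U V)) (sym (+-assoc a _ _)))
weight-modular (a ∷ cap) (outside ∷ U) (inside ∷ V) =
  trans (+-assoc a _ _) (trans (cong (a +_) (weight-modular cap U V)) (swapOut a (weight cap U) _))
  where
  swapOut : ∀ a x y → a + (x + y) ≡ x + (a + y)
  swapOut = solve-∀
weight-modular (_ ∷ cap) (outside ∷ U) (outside ∷ V) = weight-modular cap U V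

-- Truncation of `pred` at 0 only makes the right side larger. The loss of one turns a set overfull
-- for the decremented capacities into one that is full for the original ones.
weight-decrement : (cap : Vec ℕ w) (c : Fin w) (U : Subset w) →
  weight cap U ≤ suc (weight (cap [ c ]%= pred) U)
weight-decrement (a ∷ cap) zero    (inside ∷ U)  = +-monoˡ-≤ _ (≤suc-pred a)
  where
  ≤suc-pred : ∀ a → a ≤ suc (pred a)
  ≤suc-pred zero    = z≤n
  ≤suc-pred (suc a) = ≤-refl
weight-decrement (a ∷ cap) zero    (outside ∷ U) = n≤1+n _
weight-decrement (a ∷ cap) (suc c) (inside ∷ U)  =
  ≤-trans (+-monoʳ-≤ a (weight-decrement cap c U)) (≤-reflexive (+-suc a _))
weight-decrement (a ∷ cap) (suc c) (outside ∷ U) = weight-decrement cap c U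

weight-decrement-∉ : (cap : Vec ℕ w) (c : Fin w) (U : Subset w) → c ∉ U →
  weight (cap [ c ]%= pred) U ≡ weight cap U
weight-decrement-∉ (a ∷ cap) zero    (inside ∷ U)  c∉ = contradiction here c∉
weight-decrement-∉ (a ∷ cap) zero    (outside ∷ U) c∉ = refl
weight-decrement-∉ (a ∷ cap) (suc c) (inside ∷ U)  c∉ = cong (a +_) (weight-decrement-∉ cap c U (c∉ ∘ there))
weight-decrement-∉ (a ∷ cap) (suc c) (outside ∷ U) c∉ = weight-decrement-∉ cap c U (c∉ ∘ there)

covered : (Fin m → Subset w) → Subset w → ℕ
covered S U = count (λ i → S i ⊆? U)

covered-submodular : (S : Fin m → Subset w) (U V : Subset w) →
  covered S U + covered S V ≤ covered S (U ∪ V) + covered S (U ∩ V)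
covered-submodular S U V = count-submodular (λ i → S i ⊆? U) (λ i → S i ⊆? V) (λ i → S i ⊆? U ∪ V) (λ i → S i ⊆? U ∩ V)
  (λ { i (inj₁ ⊆U) → p⊆p∪q V ∘ ⊆U ; i (inj₂ ⊆V) → q⊆p∪q U V ∘ ⊆V })
  (λ i ⊆U ⊆V x∈ → x∈p∩q⁺ (⊆U x∈ , ⊆V x∈))

Choice : (Fin m → Subset w) → Vec ℕ w → Set
Choice {m} {w} S cap = Σ (Fin m → Fin w) λ g →
  (∀ i → g i ∈ S i) × (∀ c → count (λ i → g i Fin.≟ c) ≤ lookup cap c)

Overfull : (Fin m → Subset w) → Vec ℕ w → Set
Overfull S cap = ∃ λ U → weight cap U < covered S U

overfull-tail : (S : Fin (suc m) → Subset w) (cap : Vec ℕ w) → Overfull (S ∘ suc) cap → Overfull S cap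
overfull-tail S cap (U , over) = U , ≤-trans over (m≤n+m _ _)

-- At capacity 0 the decrement would change nothing and `c` would be used once too often; hence the
-- demand for a positive capacity.
choice-cons : (S : Fin (suc m) → Subset w) (cap : Vec ℕ w) {c : Fin w} → c ∈ S zero → 1 ≤ lookup cap c →
  Choice (S ∘ suc) (cap [ c ]%= pred) → Choice S cap
choice-cons {m} {w} S cap {c} c∈ 1≤cap (g , g∈ , bounded) = g′ , g′∈ , bounded′
  where
  g′ : Fin (suc m) → Fin w
  g′ zero    = c
  g′ (suc i) = g i
  g′∈ : ∀ i → g′ i ∈ S i
  g′∈ zero    = c∈
  g′∈ (suc i) = g∈ i
  suc-pred≤ : ∀ {a} → 1 ≤ a → suc (pred a) ≤ a
  suc-pred≤ (s≤s _) = ≤-refl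
  bounded′ : ∀ d → count (λ i → g′ i Fin.≟ d) ≤ lookup cap d
  bounded′ d with c Fin.≟ d
  ... | yes refl = ≤-trans (s≤s (≤-trans (bounded c) (≤-reflexive (lookup∘updateAt c cap)))) (suc-pred≤ 1≤cap)
  ... | no c≢d   = ≤-trans (bounded d) (≤-reflexive (lookup∘updateAt′ d c (c≢d ∘ sym) cap))

-- Either the first set can be served by c, or c lies in a set of colours that is already full
-- without the first set; full sets are closed under union, by submodularity.
hall : (S : Fin m → Subset w) (cap : Vec ℕ w) → Choice S cap ⊎ Overfull S cap
hall {zero}      S cap = inj₁ ((λ ()) , (λ ()) , λ _ → z≤n)
hall {suc m} {w} S cap = conclude (fullUnion (allFin w))
  where
  S′ : Fin m → Subset w
  S′ = S ∘ suc
  Full : Subset w → Set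
  Full U = weight cap U ≤ covered S′ U
  Resolved : Set
  Resolved = Choice S cap ⊎ Overfull S cap

  fullAt : ∀ c → c ∈ S zero → Resolved ⊎ ∃ λ U → c ∈ U × Full U
  fullAt c c∈ with 1 ≤? lookup cap c
  -- A colour without capacity is full by itself, its singleton having weight 0.
  ... | no 1≰ = inj₂ (⁅ c ⁆ , x∈⁅x⁆ c ,
                      ≤-trans (≤-reflexive (trans (weight-⁅⁆ cap c) (n<1⇒n≡0 (≰⇒> 1≰)))) z≤n)
  ... | yes 1≤ with hall S′ (cap [ c ]%= pred)
  ...   | inj₁ choice = inj₁ (inj₁ (choice-cons S cap c∈ 1≤ choice))
  ...   | inj₂ (U , over) with c ∈? U
  ...     | yes c∈U = inj₂ (U , c∈U , ≤-trans (weight-decrement cap c U) over)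
  ...     | no c∉U  = inj₁ (inj₂ (overfull-tail S cap
                        (U , subst (_< covered S′ U) (weight-decrement-∉ cap c U c∉U) over)))

  full-∪ : ∀ U V → Full U → Full V → Resolved ⊎ Full (U ∪ V)
  full-∪ U V fullU fullV with weight cap (U ∪ V) ≤? covered S′ (U ∪ V)
  ... | yes full = inj₂ full
  -- Modularity of `weight` against submodularity of `covered`: if the union is not full, the
  -- intersection is overfull.
  ... | no ¬full = inj₁ (inj₂ (overfull-tail S cap (U ∩ V , +-cancelˡ-< _ _ _ (begin-strict
    covered S′ (U ∪ V) + weight cap (U ∩ V)  <⟨ +-monoˡ-< _ (≰⇒> ¬full) ⟩
    weight cap (U ∪ V) + weight cap (U ∩ V)  ≡⟨ weight-modular cap U V ⟩
    weight cap U + weight cap V              ≤⟨ +-mono-≤ fullU fullV ⟩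
    covered S′ U + covered S′ V              ≤⟨ covered-submodular S′ U V ⟩
    covered S′ (U ∪ V) + covered S′ (U ∩ V)  ∎))))
    where open ≤-Reasoning

  fullUnion : ∀ cs → Resolved ⊎ ∃ λ U → (∀ {c} → c List.∈ cs → c ∈ S zero → c ∈ U) × Full U
  fullUnion [] = inj₂ (⊥ , (λ ()) , ≤-trans (≤-reflexive (weight-⊥ cap)) z≤n)
  fullUnion (c ∷ cs) with fullUnion cs | c ∈? S zero
  ... | inj₁ r                | _      = inj₁ r
  ... | inj₂ (U , ⊆U , fullU) | no c∉  =
    inj₂ (U , (λ { (here refl) c∈ → contradiction c∈ c∉ ; (there d∈) → ⊆U d∈ }) , fullU)
  ... | inj₂ (U , ⊆U , fullU) | yes c∈ with fullAt c c∈
  ...   | inj₁ r = inj₁ r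
  ...   | inj₂ (V , c∈V , fullV) with full-∪ U V fullU fullV
  ...     | inj₁ r    = inj₁ r
  ...     | inj₂ full =
    inj₂ (U ∪ V , (λ { (here refl) _ → q⊆p∪q U V c∈V ; (there d∈) d∈S → p⊆p∪q V (⊆U d∈ d∈S) }) , full)

  conclude : Resolved ⊎ (∃ λ U → (∀ {c} → c List.∈ allFin w → c ∈ S zero → c ∈ U) × Full U) → Resolved
  conclude (inj₁ r) = r
  conclude (inj₂ (U , S⊆U , full)) with S zero ⊆? U in eq
  -- The first set lies inside the full set `U`; counting it in makes `U` overfull.
  ... | yes _ = inj₂ (U , subst (λ d → weight cap U < indicator d + covered S′ U) (sym eq) (s≤s full))
  ... | no S⊈U = contradiction (λ {c} → S⊆U (∈-allFin c)) S⊈U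

-- Cardinalities of finite subsets

∣p∪⁅x⁆∣≤ : (p : Subset w) (x : Fin w) → ∣ p ∪ ⁅ x ⁆ ∣ ≤ suc ∣ p ∣
∣p∪⁅x⁆∣≤ (inside  ∷ p) zero    = s≤s (≤-trans (≤-reflexive (cong ∣_∣ (∪-identityʳ p))) (n≤1+n _))
∣p∪⁅x⁆∣≤ (outside ∷ p) zero    = s≤s (≤-reflexive (cong ∣_∣ (∪-identityʳ p)))
∣p∪⁅x⁆∣≤ (inside  ∷ p) (suc x) = s≤s (∣p∪⁅x⁆∣≤ p x)
∣p∪⁅x⁆∣≤ (outside ∷ p) (suc x) = ∣p∪⁅x⁆∣≤ p x

x∈p∪⁅x⁆ : (p : Subset w) (x : Fin w) → x ∈ p ∪ ⁅ x ⁆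
x∈p∪⁅x⁆ p x = q⊆p∪q p ⁅ x ⁆ (x∈⁅x⁆ x)

x∈p∪⁅y⁆⁻ : (p : Subset w) {x : Fin w} (y : Fin w) → x ∈ p ∪ ⁅ y ⁆ → x ∈ p ⊎ x ≡ y
x∈p∪⁅y⁆⁻ p y = Sum.map₂ (x∈⁅y⁆⇒x≡y y) ∘ x∈p∪q⁻ p ⁅ y ⁆

∣p∪⁅x⁆∣≡ : (p : Subset w) {x : Fin w} → x ∉ p → ∣ p ∪ ⁅ x ⁆ ∣ ≡ suc ∣ p ∣
∣p∪⁅x⁆∣≡ p {x} x∉p = ≤-antisym (∣p∪⁅x⁆∣≤ p x) (p⊂q⇒∣p∣<∣q∣ (p⊆p∪q ⁅ x ⁆ , x , x∈p∪⁅x⁆ p x , x∉p))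

p-x⊆q⇒p⊆q∪⁅x⁆ : {p q : Subset w} (x : Fin w) → p - x ⊆ q → p ⊆ q ∪ ⁅ x ⁆
p-x⊆q⇒p⊆q∪⁅x⁆ {q = q} x p-x⊆q {y} y∈p with y Fin.≟ x
... | yes refl = x∈p∪⁅x⁆ q x
... | no y≢x   = p⊆p∪q ⁅ x ⁆ (p-x⊆q (x∈p∧x≢y⇒x∈p-y y∈p y≢x))

⊆∧∣q∣≤∣p∣⇒≡ : {p q : Subset w} → p ⊆ q → ∣ q ∣ ≤ ∣ p ∣ → p ≡ q
⊆∧∣q∣≤∣p∣⇒≡ {p = p} {q} p⊆q ∣q∣≤∣p∣ = ⊆-antisym p⊆q q⊆p
  where
  q⊆p : q ⊆ p
  q⊆p {x} x∈q with x ∈? p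
  ... | yes x∈p = x∈p
  ... | no x∉p  = contradiction ∣q∣≤∣p∣ (<⇒≱ (p⊂q⇒∣p∣<∣q∣ (p⊆q , x , x∈q , x∉p)))

x∉p-x : (p : Subset w) (x : Fin w) → x ∉ p - x
x∉p-x (_ ∷ p) zero    ()
x∉p-x (_ ∷ p) (suc x) (there x∈) = x∉p-x p x x∈

0<∣p∣ : {p : Subset w} {x : Fin w} → x ∈ p → 0 < ∣ p ∣
0<∣p∣ x∈p = ≤-trans (s≤s z≤n) (x∈p⇒∣p-x∣<∣p∣ x∈p)

-- A `C i` with at least `κ` elements lies in a set of size `κ` only by equalling it, so distinct
-- sets of that size cover disjoint families of indices.
covered-disjoint : (C : Fin m → Subset w) → (∀ i → κ ≤ ∣ C i ∣) →
  (Ps : List (Subset w)) → Unique Ps → All (λ P → ∣ P ∣ ≡ κ) Ps → sum (map (covered C) Ps) ≤ m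
covered-disjoint {m} {w} {κ} C large Ps unique sizes = ≤-trans (go Ps unique sizes) (count≤ (hit? Ps))
  where
  hit? : (Ps : List (Subset w)) → ∀ i → Dec (Any (λ P → C i ⊆ P) Ps)
  hit? Ps i = Any.any? (λ P → C i ⊆? P) Ps
  determined : ∀ i {P} → ∣ P ∣ ≡ κ → C i ⊆ P → C i ≡ P
  determined i size C⊆P = ⊆∧∣q∣≤∣p∣⇒≡ C⊆P (≤-trans (≤-reflexive size) (large i))
  separate : ∀ {P} {Ps} → ∣ P ∣ ≡ κ → All (λ Q → ∣ Q ∣ ≡ κ) Ps → All (P ≢_) Ps →
    ∀ i → C i ⊆ P → ¬ Any (λ Q → C i ⊆ Q) Ps
  separate size (sizeQ ∷ _) (P≢Q ∷ _) i C⊆P (here C⊆Q) =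
    P≢Q (trans (sym (determined i size C⊆P)) (determined i sizeQ C⊆Q))
  separate size (_ ∷ sizes) (_ ∷ P≢Ps) i C⊆P (there hit) = separate size sizes P≢Ps i C⊆P hit
  go : ∀ Ps → Unique Ps → All (λ P → ∣ P ∣ ≡ κ) Ps → sum (map (covered C) Ps) ≤ count (hit? Ps)
  go []       _                _              = z≤n
  go (P ∷ Ps) (P≢Ps ∷ unique) (size ∷ sizes) = ≤-trans
    (+-monoʳ-≤ (covered C P) (go Ps unique sizes))
    (count-disjoint (λ i → C i ⊆? P) (hit? Ps) (hit? (P ∷ Ps))
      (λ { i (inj₁ C⊆P) → here C⊆P ; i (inj₂ hit) → there hit })
      (separate size sizes P≢Ps))

-- Obstructions

-- What a violation of Hall's condition leaves behind once the centres have colours `x` and `y`; `κ`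
-- stands for k - 1. When every list has at least `suc κ` colours, a leaf is covered by a hull only
-- if its list equals that hull.
record Obstruction {m₁ m₂ w : ℕ} (κ ρ : ℕ) (C₁ : Fin m₁ → Subset w) (C₂ : Fin m₂ → Subset w)
                   (x y : Fin w) : Set where
  field
    core  : Subset w
    size  : ∣ core ∣ ≡ κ
    x∉    : x ∉ core
    y∉    : y ∉ core
    heavy : ρ * κ < covered C₁ (core ∪ ⁅ x ⁆) + covered C₂ (core ∪ ⁅ y ⁆)

  hull₁ hull₂ : Subset w
  hull₁ = core ∪ ⁅ x ⁆
  hull₂ = core ∪ ⁅ y ⁆

  size₁ : ∣ hull₁ ∣ ≡ suc κ
  size₁ = trans (∣p∪⁅x⁆∣≡ core x∉) (cong suc size)

  size₂ : ∣ hull₂ ∣ ≡ suc κ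
  size₂ = trans (∣p∪⁅x⁆∣≡ core y∉) (cong suc size)

open Obstruction

swap : {m₁ m₂ w κ ρ : ℕ} {C₁ : Fin m₁ → Subset w} {C₂ : Fin m₂ → Subset w} {x y : Fin w} →
  Obstruction κ ρ C₁ C₂ x y → Obstruction κ ρ C₂ C₁ y x
swap {κ = κ} {ρ} {C₁} {C₂} β = record
  { core = core β ; size = size β ; x∉ = y∉ β ; y∉ = x∉ β
  ; heavy = subst (ρ * κ <_) (+-comm (covered C₁ (hull₁ β)) _) (heavy β) }

module _ {m₁ m₂ w κ ρ : ℕ} {C₁ : Fin m₁ → Subset w} {C₂ : Fin m₂ → Subset w} where

  -- Lying outside both cores, a `y` in the common hull would equal `x` and `x′` at once.
  y∉hull₁ : ∀ {x x′ y y′} (β : Obstruction κ ρ C₁ C₂ x y) (β′ : Obstruction κ ρ C₁ C₂ x′ y′) →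
    x ≢ x′ → y ≡ y′ → hull₁ β ≡ hull₁ β′ → y ∉ hull₁ β
  y∉hull₁ {x} {x′} β β′ x≢x′ refl P≡P′ y∈P
    with x∈p∪⁅y⁆⁻ (core β) x y∈P | x∈p∪⁅y⁆⁻ (core β′) x′ (subst (_ ∈_) P≡P′ y∈P)
  ... | inj₁ y∈U | _         = y∉ β y∈U
  ... | inj₂ _   | inj₁ y∈U′ = y∉ β′ y∈U′
  ... | inj₂ y≡x | inj₂ y≡x′ = x≢x′ (trans (sym y≡x) y≡x′)

  -- By the common first hull, `x` is in the core of `β′`. Were the second hulls equal, `x` would be
  -- in `hull₂ β` but not in its core, so `x` would be `y`, which `y∉hull₁` excludes.
  hull₂≢-by-x : ∀ {x x′ y} (β : Obstruction κ ρ C₁ C₂ x y) (β′ : Obstruction κ ρ C₁ C₂ x′ y) →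
    x ≢ x′ → hull₁ β ≡ hull₁ β′ → hull₂ β ≢ hull₂ β′
  hull₂≢-by-x {x} {x′} {y} β β′ x≢x′ P≡P′ Q≡Q′
    with x∈p∪⁅y⁆⁻ (core β′) x′ (subst (x ∈_) P≡P′ (x∈p∪⁅x⁆ (core β) x))
  ... | inj₂ x≡x′ = x≢x′ x≡x′
  ... | inj₁ x∈U′ with x∈p∪⁅y⁆⁻ (core β) y (subst (x ∈_) (sym Q≡Q′) (p⊆p∪q ⁅ y ⁆ x∈U′))
  ...   | inj₁ x∈U  = x∉ β x∈U
  ...   | inj₂ refl = y∉hull₁ β β′ x≢x′ refl P≡P′ (x∈p∪⁅x⁆ (core β) x)

  -- Were the second hulls equal, `y` would be `y′` or lie in the core of `β′`, hence in the first
  -- hull. The premise `y ∉ hull₁ β` leaves open whether the first centres agree.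
  hull₂≢-by-y : ∀ {x x′ y y′} (β : Obstruction κ ρ C₁ C₂ x y) (β′ : Obstruction κ ρ C₁ C₂ x′ y′) →
    y ≢ y′ → y ∉ hull₁ β → hull₁ β ≡ hull₁ β′ → hull₂ β ≢ hull₂ β′
  hull₂≢-by-y {x′ = x′} {y} {y′} β β′ y≢y′ y∉P P≡P′ Q≡Q′
    with x∈p∪⁅y⁆⁻ (core β′) y′ (subst (y ∈_) Q≡Q′ (x∈p∪⁅x⁆ (core β) y))
  ... | inj₁ y∈U′ = y∉P (subst (y ∈_) (sym P≡P′) (p⊆p∪q ⁅ x′ ⁆ y∈U′))
  ... | inj₂ y≡y′ = y≢y′ y≡y′

  -- More than `ρ * κ` leaves must fit into `ρ * suc κ` places beside the two centres. This disposes
  -- of the case `ρ < 2`.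
  obstruction⇒3≤ρ : ∀ {x y} → suc m₁ + suc m₂ ≤ ρ * suc κ → Obstruction κ ρ C₁ C₂ x y → 3 ≤ ρ
  obstruction⇒3≤ρ fits β = +-cancelʳ-≤ (ρ * κ) 3 ρ (begin
    2 + suc (ρ * κ)                                      ≤⟨ +-monoʳ-≤ 2 (heavy β) ⟩
    2 + (covered C₁ (hull₁ β) + covered C₂ (hull₂ β))
      ≤⟨ +-monoʳ-≤ 2 (+-mono-≤ (count≤ (λ i → C₁ i ⊆? hull₁ β)) (count≤ (λ i → C₂ i ⊆? hull₂ β))) ⟩
    2 + (m₁ + m₂)                                        ≡⟨ cong suc (+-suc m₁ m₂) ⟨
    suc m₁ + suc m₂                                      ≤⟨ fits ⟩
    ρ * suc κ                                            ≡⟨ *-suc ρ κ ⟩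
    ρ + ρ * κ                                            ∎)
    where open ≤-Reasoning

  module _ (large₁ : ∀ i → suc κ ≤ ∣ C₁ i ∣) (large₂ : ∀ i → suc κ ≤ ∣ C₂ i ∣)
           (m₁< : m₁ < ρ * κ) (m₂< : m₂ < ρ * κ) where

    -- Otherwise the two obstructions count disjoint families of leaves, more than twice `ρ * κ`
    -- altogether, while each star has fewer than `ρ * κ` leaves.
    share-hull : ∀ {x x′ y y′} (β : Obstruction κ ρ C₁ C₂ x y) (β′ : Obstruction κ ρ C₁ C₂ x′ y′) →
      hull₁ β ≡ hull₁ β′ ⊎ hull₂ β ≡ hull₂ β′
    share-hull β β′ with ≡-dec Bool._≟_ (hull₁ β) (hull₁ β′) | ≡-dec Bool._≟_ (hull₂ β) (hull₂ β′)
    ... | yes P≡P′ | _        = inj₁ P≡P′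
    ... | no _     | yes Q≡Q′ = inj₂ Q≡Q′
    ... | no P≢P′  | no Q≢Q′  = contradiction (begin-strict
      ρ * κ + ρ * κ                         <⟨ +-mono-< (heavy β) (heavy β′) ⟩
      (p + q) + (p′ + q′)                   ≡⟨ regroup p q p′ q′ ⟩
      (p + (p′ + 0)) + (q + (q′ + 0))
        ≤⟨ +-mono-≤ (covered-disjoint C₁ large₁ (hull₁ β ∷ hull₁ β′ ∷ [])
                      ((P≢P′ ∷ []) ∷ [] ∷ []) (size₁ β ∷ size₁ β′ ∷ []))
                    (covered-disjoint C₂ large₂ (hull₂ β ∷ hull₂ β′ ∷ [])
                      ((Q≢Q′ ∷ []) ∷ [] ∷ []) (size₂ β ∷ size₂ β′ ∷ [])) ⟩
      m₁ + m₂                               <⟨ +-mono-< m₁< m₂< ⟩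
      ρ * κ + ρ * κ                         ∎) (n≮n _)
      where
      open ≤-Reasoning
      p q p′ q′ : ℕ
      p  = covered C₁ (hull₁ β)
      q  = covered C₂ (hull₂ β)
      p′ = covered C₁ (hull₁ β′)
      q′ = covered C₂ (hull₂ β′)
      regroup : ∀ p q p′ q′ → (p + q) + (p′ + q′) ≡ (p + (p′ + 0)) + (q + (q′ + 0))
      regroup = solve-∀

    -- The first star supplies at most `ρ * κ - 1` of the at least `ρ * κ + 1` leaves of an
    -- obstruction.
    2≤covered₂ : ∀ {x y} (β : Obstruction κ ρ C₁ C₂ x y) → 2 ≤ covered C₂ (hull₂ β)
    2≤covered₂ β = +-cancelˡ-≤ m₁ 2 _ (begin
      m₁ + 2                                       ≡⟨ +-comm m₁ 2 ⟩
      suc (suc m₁)                                 ≤⟨ s≤s m₁< ⟩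
      suc (ρ * κ)                                  ≤⟨ heavy β ⟩
      covered C₁ (hull₁ β) + covered C₂ (hull₂ β)  ≤⟨ +-monoˡ-≤ _ (count≤ (λ i → C₁ i ⊆? hull₁ β)) ⟩
      m₁ + covered C₂ (hull₂ β)                    ∎)
      where open ≤-Reasoning

    -- The second hulls are distinct, so their leaves are too. `β₁` accounts for at least
    -- `ρ * κ + 1` leaves and each other obstruction for two more in the second star, which is one
    -- leaf too many for `few`.
    no-common-hull₁ : ∀ {a a′ b b′} → a ≢ a′ → b ≢ b′ → m₁ + m₂ ≤ 6 + ρ * κ →
      (β₁ : Obstruction κ ρ C₁ C₂ a b) (β₂ : Obstruction κ ρ C₁ C₂ a′ b)
      (β₃ : Obstruction κ ρ C₁ C₂ a b′) (β₄ : Obstruction κ ρ C₁ C₂ a′ b′) →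
      hull₁ β₁ ≡ hull₁ β₂ → hull₁ β₁ ≡ hull₁ β₃ → ¬ hull₁ β₁ ≡ hull₁ β₄
    no-common-hull₁ {b = b} a≢a′ b≢b′ few β₁ β₂ β₃ β₄ P₁₂ P₁₃ P₁₄ = contradiction (begin-strict
      m₁ + m₂                                ≤⟨ few ⟩
      6 + ρ * κ                              <⟨ +-monoʳ-< 6 (heavy β₁) ⟩
      6 + (covered C₁ (hull₁ β₁) + q₁)       ≡⟨ regroup (covered C₁ (hull₁ β₁)) q₁ ⟩
      covered C₁ (hull₁ β₁) + (q₁ + (2 + (2 + (2 + 0))))
        ≤⟨ +-mono-≤ (count≤ (λ i → C₁ i ⊆? hull₁ β₁))
             (+-monoʳ-≤ q₁ (+-mono-≤ (2≤covered₂ β₂) (+-mono-≤ (2≤covered₂ β₃) (+-monoˡ-≤ 0 (2≤covered₂ β₄))))) ⟩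
      m₁ + sum (map (covered C₂) (hull₂ β₁ ∷ hull₂ β₂ ∷ hull₂ β₃ ∷ hull₂ β₄ ∷ []))
        ≤⟨ +-monoʳ-≤ m₁ (covered-disjoint C₂ large₂ _ distinct (size₂ β₁ ∷ size₂ β₂ ∷ size₂ β₃ ∷ size₂ β₄ ∷ [])) ⟩
      m₁ + m₂                                ∎) (n≮n _)
      where
      open ≤-Reasoning
      q₁ : ℕ
      q₁ = covered C₂ (hull₂ β₁)
      regroup : ∀ p q → 6 + (p + q) ≡ p + (q + (2 + (2 + (2 + 0))))
      regroup = solve-∀
      P₂₃ : hull₁ β₂ ≡ hull₁ β₃
      P₂₃ = trans (sym P₁₂) P₁₃
      P₂₄ : hull₁ β₂ ≡ hull₁ β₄
      P₂₄ = trans (sym P₁₂) P₁₄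
      b∉P₁ : b ∉ hull₁ β₁
      b∉P₁ = y∉hull₁ β₁ β₂ a≢a′ refl P₁₂
      b∉P₂ : b ∉ hull₁ β₂
      b∉P₂ = subst (b ∉_) P₁₂ b∉P₁
      distinct : Unique (hull₂ β₁ ∷ hull₂ β₂ ∷ hull₂ β₃ ∷ hull₂ β₄ ∷ [])
      -- Pairs with the same second centre go by `hull₂≢-by-x`; all others, even those differing in
      -- both centres, by `hull₂≢-by-y`.
      distinct =
        (hull₂≢-by-x β₁ β₂ a≢a′ P₁₂ ∷ hull₂≢-by-y β₁ β₃ b≢b′ b∉P₁ P₁₃ ∷ hull₂≢-by-y β₁ β₄ b≢b′ b∉P₁ P₁₄ ∷ []) ∷
        (hull₂≢-by-y β₂ β₃ b≢b′ b∉P₂ P₂₃ ∷ hull₂≢-by-y β₂ β₄ b≢b′ b∉P₂ P₂₄ ∷ []) ∷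
        (hull₂≢-by-x β₃ β₄ a≢a′ (trans (sym P₁₃) P₁₄) ∷ []) ∷ [] ∷ []

-- Suppose `β₁` and `β₂` share one hull. Their other hulls then differ, so no further obstruction
-- shares that other hull with both, and it must share the common one.
not-all-obstructed : {m₁ m₂ w κ ρ : ℕ} {C₁ : Fin m₁ → Subset w} {C₂ : Fin m₂ → Subset w} →
  (∀ i → suc κ ≤ ∣ C₁ i ∣) → (∀ i → suc κ ≤ ∣ C₂ i ∣) → m₁ < ρ * κ → m₂ < ρ * κ → m₁ + m₂ ≤ 6 + ρ * κ →
  ∀ {a a′ b b′} → a ≢ a′ → b ≢ b′ →
  Obstruction κ ρ C₁ C₂ a b → Obstruction κ ρ C₁ C₂ a′ b →
  Obstruction κ ρ C₁ C₂ a b′ → ¬ Obstruction κ ρ C₁ C₂ a′ b′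
not-all-obstructed {m₁} {m₂} {w} {κ} {ρ} {C₁} {C₂} large₁ large₂ m₁< m₂< few a≢a′ b≢b′ β₁ β₂ β₃ β₄
  with share-hull large₁ large₂ m₁< m₂< β₁ β₂
... | inj₁ P₁₂ = no-common-hull₁ large₁ large₂ m₁< m₂< a≢a′ b≢b′ few β₁ β₂ β₃ β₄ P₁₂ (shared β₃) (shared β₄)
  where
  shared : ∀ {x y} (β : Obstruction κ ρ C₁ C₂ x y) → hull₁ β₁ ≡ hull₁ β
  shared β with share-hull large₁ large₂ m₁< m₂< β₁ β | share-hull large₁ large₂ m₁< m₂< β₂ β
  ... | inj₁ P₁≡P | _         = P₁≡P
  ... | inj₂ _    | inj₁ P₂≡P = trans P₁₂ P₂≡P
  ... | inj₂ Q₁≡Q | inj₂ Q₂≡Q = contradiction (trans Q₁≡Q (sym Q₂≡Q)) (hull₂≢-by-x β₁ β₂ a≢a′ P₁₂)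
-- Exchanging the stars exchanges the roles of the two centres, so `β₂` and `β₃` trade places.
... | inj₂ Q₁₂ = no-common-hull₁ large₂ large₁ m₂< m₁< b≢b′ a≢a′
                   (subst (_≤ 6 + ρ * κ) (+-comm m₁ m₂) few)
                   (swap β₁) (swap β₃) (swap β₂) (swap β₄) (shared β₃) Q₁₂ (shared β₄)
  where
  shared : ∀ {x y} (β : Obstruction κ ρ C₁ C₂ x y) → hull₂ β₁ ≡ hull₂ β
  shared β with share-hull large₁ large₂ m₁< m₂< β₁ β | share-hull large₁ large₂ m₁< m₂< β₂ β
  ... | inj₂ Q₁≡Q | _         = Q₁≡Q
  ... | inj₁ _    | inj₂ Q₂≡Q = trans Q₁₂ Q₂≡Q
  ... | inj₁ P₁≡P | inj₁ P₂≡P = contradiction Q₁₂ (hull₂≢-by-x β₁ β₂ a≢a′ (trans P₁≡P (sym P₂≡P)))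

-- Colouring two stars with prescribed colours of the centres

-- With the centre's colour fixed and deleted from the leaves, every choice is proper and only the
-- capacities remain for `hall`.
starSets : Fin w → (Fin m → Subset w) → Fin (suc m) → Subset w
starSets c C zero    = ⁅ c ⁆
starSets c C (suc i) = C i - c

twoStarSets : {m₁ m₂ w : ℕ} → (Fin m₁ → Subset w) → (Fin m₂ → Subset w) → Fin w → Fin w →
  Fin (suc m₁) ⊎ Fin (suc m₂) → Subset w
twoStarSets C₁ C₂ x y = [ starSets x C₁ , starSets y C₂ ]′

StarChoice : {m₁ m₂ w : ℕ} → (Fin m₁ → Subset w) → (Fin m₂ → Subset w) → ℕ → Fin w → Fin w → Set
StarChoice {m₁} {w = w} C₁ C₂ ρ x y = Choice (twoStarSets C₁ C₂ x y ∘ splitAt (suc m₁)) (replicate w ρ)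

-- If `C i - c` fits into `U`, the at least `suc κ` colours of `C i` fit into `U ∪ ⁅ c ⁆`; this
-- forces `c ∉ U` and size exactly `κ`.
leaves-covered : (C : Fin m → Subset w) → (∀ i → suc κ ≤ ∣ C i ∣) → (c : Fin w) (U : Subset w) → ∣ U ∣ ≤ κ →
  covered (λ i → C i - c) U ≡ 0 ⊎ (c ∉ U × ∣ U ∣ ≡ κ)
leaves-covered C large c U ∣U∣≤κ with any? (λ i → (C i - c) ⊆? U)
... | no none = inj₁ (count-none _ (λ i C-c⊆U → none (i , C-c⊆U)))
... | yes (i , C-c⊆U) = inj₂ (c∉U , ≤-antisym ∣U∣≤κ (≤-pred (≤-trans (large i)
                          (≤-trans (p⊆q⇒∣p∣≤∣q∣ (p-x⊆q⇒p⊆q∪⁅x⁆ c C-c⊆U)) (∣p∪⁅x⁆∣≤ U c)))))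
  where
  c∉U : c ∉ U
  c∉U c∈U = contradiction (≤-trans (large i) (≤-trans (p⊆q⇒∣p∣≤∣q∣ C⊆U) ∣U∣≤κ)) (n≮n _)
    where
    C⊆U : C i ⊆ U
    C⊆U {d} d∈ with x∈p∪⁅y⁆⁻ U c (p-x⊆q⇒p⊆q∪⁅x⁆ c C-c⊆U d∈)
    ... | inj₁ d∈U  = d∈U
    ... | inj₂ refl = c∈U

-- The centres alone never violate Hall's condition: if both lie in `U`, then `U` has two colours or
-- one colour has capacity two.
covered-centres : {ρ : ℕ} (x y : Fin w) (U : Subset w) → 1 ≤ ρ → x ≢ y ⊎ 2 ≤ ρ →
  indicator (⁅ x ⁆ ⊆? U) + indicator (⁅ y ⁆ ⊆? U) ≤ ρ * ∣ U ∣
covered-centres x y U 1≤ρ distinct⊎2≤ρ with ⁅ x ⁆ ⊆? U | ⁅ y ⁆ ⊆? U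
... | no _    | no _    = z≤n
... | no _    | yes y⊆U = *-mono-≤ 1≤ρ (0<∣p∣ (y⊆U (x∈⁅x⁆ y)))
... | yes x⊆U | no _    = *-mono-≤ 1≤ρ (0<∣p∣ (x⊆U (x∈⁅x⁆ x)))
... | yes x⊆U | yes y⊆U with distinct⊎2≤ρ
...   | inj₂ 2≤ρ = *-mono-≤ 2≤ρ (0<∣p∣ (x⊆U (x∈⁅x⁆ x)))
...   | inj₁ x≢y = *-mono-≤ 1≤ρ (≤-trans (s≤s (0<∣p∣ (x∈p∧x≢y⇒x∈p-y (x⊆U (x∈⁅x⁆ x)) x≢y)))
                                          (x∈p⇒∣p-x∣<∣p∣ (y⊆U (x∈⁅x⁆ y))))

covered-remove : (C : Fin m → Subset w) (c : Fin w) (U : Subset w) →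
  covered (λ i → C i - c) U ≤ covered C (U ∪ ⁅ c ⁆)
covered-remove C c U =
  count-mono (λ i → (C i - c) ⊆? U) (λ i → C i ⊆? U ∪ ⁅ c ⁆) (λ i C-c⊆U → p-x⊆q⇒p⊆q∪⁅x⁆ c C-c⊆U)

indicator-⁅⁆-∉ : {x : Fin w} {U : Subset w} → x ∉ U → indicator (⁅ x ⁆ ⊆? U) ≡ 0
indicator-⁅⁆-∉ {x = x} {U} x∉U with ⁅ x ⁆ ⊆? U
... | yes x⊆U = contradiction (x⊆U (x∈⁅x⁆ x)) x∉U
... | no _    = refl

-- A violating `U` has at most `κ` colours, since `suc κ` colours have capacity for all vertices. It
-- must cover leaves of both stars, and `leaves-covered` then makes it a core.
colour⊎obstruction : {m₁ m₂ w κ ρ : ℕ} (C₁ : Fin m₁ → Subset w) (C₂ : Fin m₂ → Subset w) →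
  (∀ i → suc κ ≤ ∣ C₁ i ∣) → (∀ i → suc κ ≤ ∣ C₂ i ∣) →
  suc m₁ + suc m₂ ≤ ρ * suc κ → m₁ < ρ * κ → m₂ < ρ * κ →
  (x y : Fin w) → x ≢ y ⊎ 2 ≤ ρ →
  StarChoice C₁ C₂ ρ x y ⊎ Obstruction κ ρ C₁ C₂ x y
colour⊎obstruction {m₁} {m₂} {w} {κ} {ρ} C₁ C₂ large₁ large₂ fits m₁< m₂< x y distinct⊎2≤ρ
  with hall (twoStarSets C₁ C₂ x y ∘ splitAt (suc m₁)) (replicate w ρ)
... | inj₁ choice     = inj₁ choice
... | inj₂ (U , over) = inj₂ (obstruction (leaves-covered C₁ large₁ x U ∣U∣≤κ) (leaves-covered C₂ large₂ y U ∣U∣≤κ))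
  where
  open ≤-Reasoning
  δ₁ δ₂ ℓ₁ ℓ₂ : ℕ
  δ₁ = indicator (⁅ x ⁆ ⊆? U)
  δ₂ = indicator (⁅ y ⁆ ⊆? U)
  ℓ₁ = covered (λ i → C₁ i - x) U
  ℓ₂ = covered (λ i → C₂ i - y) U

  over′ : ρ * ∣ U ∣ < (δ₁ + ℓ₁) + (δ₂ + ℓ₂)
  over′ = subst₂ _<_ (weight-replicate ρ U) (count-splitAt (suc m₁) (λ s → twoStarSets C₁ C₂ x y s ⊆? U)) over

  1≤ρ : 1 ≤ ρ
  1≤ρ = *-cancelʳ-< κ 0 ρ (≤-trans (s≤s z≤n) m₁<)

  ℓ₁≤ : ℓ₁ ≤ m₁
  ℓ₁≤ = count≤ (λ i → (C₁ i - x) ⊆? U)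
  ℓ₂≤ : ℓ₂ ≤ m₂
  ℓ₂≤ = count≤ (λ i → (C₂ i - y) ⊆? U)

  ∣U∣≤κ : ∣ U ∣ ≤ κ
  ∣U∣≤κ = ≮⇒≥ (λ κ<∣U∣ → contradiction (begin-strict
    ρ * suc κ              ≤⟨ *-monoʳ-≤ ρ κ<∣U∣ ⟩
    ρ * ∣ U ∣              <⟨ over′ ⟩
    (δ₁ + ℓ₁) + (δ₂ + ℓ₂)  ≤⟨ +-mono-≤ (+-mono-≤ (indicator≤1 (⁅ x ⁆ ⊆? U)) ℓ₁≤) (+-mono-≤ (indicator≤1 (⁅ y ⁆ ⊆? U)) ℓ₂≤) ⟩
    suc m₁ + suc m₂        ≤⟨ fits ⟩
    ρ * suc κ              ∎) (n≮n _))

  obstruction : ℓ₁ ≡ 0 ⊎ (x ∉ U × ∣ U ∣ ≡ κ) → ℓ₂ ≡ 0 ⊎ (y ∉ U × ∣ U ∣ ≡ κ) → Obstruction κ ρ C₁ C₂ x y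
  obstruction (inj₁ ℓ₁≡0) (inj₁ ℓ₂≡0) = contradiction (begin-strict
    ρ * ∣ U ∣              <⟨ over′ ⟩
    (δ₁ + ℓ₁) + (δ₂ + ℓ₂)  ≡⟨ cong₂ (λ a b → (δ₁ + a) + (δ₂ + b)) ℓ₁≡0 ℓ₂≡0 ⟩
    (δ₁ + 0) + (δ₂ + 0)    ≡⟨ cong₂ _+_ (+-identityʳ δ₁) (+-identityʳ δ₂) ⟩
    δ₁ + δ₂                ≤⟨ covered-centres x y U 1≤ρ distinct⊎2≤ρ ⟩
    ρ * ∣ U ∣              ∎) (n≮n _)
  -- Besides leaves of the second star only the first centre can be covered, so at most `suc m₂`
  -- sets are; the strictness of `m₂ < ρ * κ` absorbs that centre.
  obstruction (inj₁ ℓ₁≡0) (inj₂ (y∉U , ∣U∣≡κ)) = contradiction (begin-strict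
    ρ * κ                  ≡⟨ cong (ρ *_) ∣U∣≡κ ⟨
    ρ * ∣ U ∣              <⟨ over′ ⟩
    (δ₁ + ℓ₁) + (δ₂ + ℓ₂)  ≡⟨ cong₂ (λ a b → (δ₁ + a) + (b + ℓ₂)) ℓ₁≡0 (indicator-⁅⁆-∉ y∉U) ⟩
    (δ₁ + 0) + ℓ₂          ≤⟨ +-mono-≤ (+-monoˡ-≤ 0 (indicator≤1 (⁅ x ⁆ ⊆? U))) ℓ₂≤ ⟩
    suc m₂                 ≤⟨ m₂< ⟩
    ρ * κ                  ∎) (n≮n _)
  obstruction (inj₂ (x∉U , ∣U∣≡κ)) (inj₁ ℓ₂≡0) = contradiction (begin-strict
    ρ * κ                  ≡⟨ cong (ρ *_) ∣U∣≡κ ⟨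
    ρ * ∣ U ∣              <⟨ over′ ⟩
    (δ₁ + ℓ₁) + (δ₂ + ℓ₂)  ≡⟨ cong₂ (λ a b → (a + ℓ₁) + (δ₂ + b)) (indicator-⁅⁆-∉ x∉U) ℓ₂≡0 ⟩
    ℓ₁ + (δ₂ + 0)          ≤⟨ +-mono-≤ ℓ₁≤ (+-monoˡ-≤ 0 (indicator≤1 (⁅ y ⁆ ⊆? U))) ⟩
    m₁ + 1                 ≡⟨ +-comm m₁ 1 ⟩
    suc m₁                 ≤⟨ m₁< ⟩
    ρ * κ                  ∎) (n≮n _)
  obstruction (inj₂ (x∉U , ∣U∣≡κ)) (inj₂ (y∉U , _)) = record
    { core = U ; size = ∣U∣≡κ ; x∉ = x∉U ; y∉ = y∉U ; heavy = begin-strict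
      ρ * κ                                        ≡⟨ cong (ρ *_) ∣U∣≡κ ⟨
      ρ * ∣ U ∣                                    <⟨ over′ ⟩
      (δ₁ + ℓ₁) + (δ₂ + ℓ₂)
        ≡⟨ cong₂ (λ a b → (a + ℓ₁) + (b + ℓ₂)) (indicator-⁅⁆-∉ x∉U) (indicator-⁅⁆-∉ y∉U) ⟩
      ℓ₁ + ℓ₂
        ≤⟨ +-mono-≤ (covered-remove C₁ x U) (covered-remove C₂ y U) ⟩
      covered C₁ (U ∪ ⁅ x ⁆) + covered C₂ (U ∪ ⁅ y ⁆)  ∎ }

colour-two-stars : {m₁ m₂ w κ ρ : ℕ} (C₁ : Fin m₁ → Subset w) (C₂ : Fin m₂ → Subset w) →
  (∀ i → suc κ ≤ ∣ C₁ i ∣) → (∀ i → suc κ ≤ ∣ C₂ i ∣) →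
  suc m₁ + suc m₂ ≤ ρ * suc κ → m₁ < ρ * κ → m₂ < ρ * κ → m₁ + m₂ ≤ 6 + ρ * κ →
  ∀ {a a′ b b′} → a ≢ a′ → b ≢ b′ →
  ∃₂ λ x y → (x ≡ a ⊎ x ≡ a′) × (y ≡ b ⊎ y ≡ b′) ×
    StarChoice C₁ C₂ ρ x y
colour-two-stars {m₁} {m₂} {w} {κ} {ρ} C₁ C₂ large₁ large₂ fits m₁< m₂< few {a} {a′} {b} {b′} a≢a′ b≢b′
  with 2 ≤? ρ
... | yes 2≤ρ = search (attempt a b) (attempt a′ b) (attempt a b′) (attempt a′ b′)
  where
  attempt : ∀ x y → StarChoice C₁ C₂ ρ x y ⊎ Obstruction κ ρ C₁ C₂ x y
  attempt x y = colour⊎obstruction C₁ C₂ large₁ large₂ fits m₁< m₂< x y (inj₂ 2≤ρ)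
  search : StarChoice C₁ C₂ ρ a b ⊎ Obstruction κ ρ C₁ C₂ a b → StarChoice C₁ C₂ ρ a′ b ⊎ Obstruction κ ρ C₁ C₂ a′ b →
    StarChoice C₁ C₂ ρ a b′ ⊎ Obstruction κ ρ C₁ C₂ a b′ → StarChoice C₁ C₂ ρ a′ b′ ⊎ Obstruction κ ρ C₁ C₂ a′ b′ →
    ∃₂ λ x y → (x ≡ a ⊎ x ≡ a′) × (y ≡ b ⊎ y ≡ b′) × StarChoice C₁ C₂ ρ x y
  search (inj₁ f) _ _ _ = a , b , inj₁ refl , inj₁ refl , f
  search _ (inj₁ f) _ _ = a′ , b , inj₂ refl , inj₁ refl , f
  search _ _ (inj₁ f) _ = a , b′ , inj₁ refl , inj₂ refl , f
  search _ _ _ (inj₁ f) = a′ , b′ , inj₂ refl , inj₂ refl , f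
  search (inj₂ β₁) (inj₂ β₂) (inj₂ β₃) (inj₂ β₄) =
    contradiction β₄ (not-all-obstructed large₁ large₂ m₁< m₂< few a≢a′ b≢b′ β₁ β₂ β₃)
-- Here one colour cannot serve both centres. Distinct centre colours suffice, as an obstruction
-- would need `3 ≤ ρ`; if `a` is `b`, then `a′` differs from `b`.
... | no 2≰ρ = pick (a Fin.≟ b)
  where
  colour : ∀ x y → x ≢ y → StarChoice C₁ C₂ ρ x y
  colour x y x≢y with colour⊎obstruction C₁ C₂ large₁ large₂ fits m₁< m₂< x y (inj₁ x≢y)
  ... | inj₁ f = f
  ... | inj₂ β = contradiction (≤-trans (n≤1+n 2) (obstruction⇒3≤ρ fits β)) 2≰ρ
  pick : Dec (a ≡ b) → ∃₂ λ x y → (x ≡ a ⊎ x ≡ a′) × (y ≡ b ⊎ y ≡ b′) × StarChoice C₁ C₂ ρ x y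
  pick (no a≢b)   = a , b , inj₁ refl , inj₁ refl , colour a b a≢b
  pick (yes refl) = a′ , b , inj₂ refl , inj₁ refl , colour a′ b (a≢a′ ∘ sym)

-- From lists of colours to subsets

colours : (w : ℕ) → List ℕ → Subset w
colours w xs = Vec.tabulate (λ j → does (toℕ j ∈ˡ? xs))

∈-colours⁺ : (xs : List ℕ) {j : Fin w} → toℕ j List.∈ xs → j ∈ colours w xs
∈-colours⁺ xs {j} j∈ = lookup⇒[]= j _ (trans (lookup∘tabulate _ j) (dec-true (toℕ j ∈ˡ? xs) j∈))

∈-colours⁻ : (xs : List ℕ) {j : Fin w} → j ∈ colours w xs → toℕ j List.∈ xs
∈-colours⁻ xs {j} j∈ with toℕ j ∈ˡ? xs | trans (sym (lookup∘tabulate (λ i → does (toℕ i ∈ˡ? xs)) j)) ([]=⇒lookup j∈)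
... | yes j∈xs | _ = j∈xs

length≤∣colours∣ : {xs : List ℕ} → Unique xs → All (_< w) xs → length xs ≤ ∣ colours w xs ∣
length≤∣colours∣ []                               []           = z≤n
length≤∣colours∣ {w} {x ∷ xs} (x≢xs ∷ unique) (x<w ∷ xs<w) = ≤-trans
  (s≤s (length≤∣colours∣ unique xs<w))
  (p⊂q⇒∣p∣<∣q∣ ((λ d∈ → ∈-colours⁺ (x ∷ xs) (there (∈-colours⁻ xs d∈))) ,
                fromℕ< x<w ,
                ∈-colours⁺ (x ∷ xs) (here (toℕ-fromℕ< x<w)) ,
                λ x∈ → All.lookup x≢xs (∈-colours⁻ xs x∈) (sym (toℕ-fromℕ< x<w))))

two-colours : {xs : List ℕ} → Unique xs → 2 ≤ length xs → All (_< w) xs →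
  ∃₂ λ (a a′ : Fin w) → a ≢ a′ × toℕ a List.∈ xs × toℕ a′ List.∈ xs
two-colours ((x≢y ∷ _) ∷ _) (s≤s (s≤s _)) (x<w ∷ y<w ∷ _) =
  fromℕ< x<w , fromℕ< y<w ,
  (λ eq → x≢y (trans (sym (toℕ-fromℕ< x<w)) (trans (cong toℕ eq) (toℕ-fromℕ< y<w)))) ,
  here (toℕ-fromℕ< x<w) , there (here (toℕ-fromℕ< y<w))

palette-bounded : (L : ListAssignment n) {c : ℕ} → c List.∈ palette L → c < suc (max 0 (palette L))
palette-bounded L c∈ = s≤s (All.lookup (xs≤max 0 (palette L)) c∈)

∈-palette : (L : ListAssignment n) (v : Fin n) {c : ℕ} → c List.∈ L v → c List.∈ palette L
∈-palette {n} L v c∈ = ∈-concatMap⁺ L (Any.map (λ { refl → c∈ }) (∈-allFin v))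

-- Properness and equitability of a choice

starSets-proper : (C : Fin m → Subset w) (c : Fin w) {i j : Fin (suc m)} {x y : Fin w} →
  x ∈ starSets c C i → y ∈ starSets c C j → StarAdj i j → x ≢ y
starSets-proper C c {j = zero}  x∈ y∈ (inj₁ (refl , j≢0)) refl = j≢0 refl
starSets-proper C c {j = suc j} x∈ y∈ (inj₁ (refl , j≢0)) refl =
  subst (_∉ C j - c) (sym (x∈⁅y⁆⇒x≡y c x∈)) (x∉p-x (C j) c) y∈
starSets-proper C c {i = zero}  x∈ y∈ (inj₂ (refl , i≢0)) refl = i≢0 refl
starSets-proper C c {i = suc i} x∈ y∈ (inj₂ (refl , i≢0)) refl =
  subst (_∉ C i - c) (sym (x∈⁅y⁆⇒x≡y c y∈)) (x∉p-x (C i) c) x∈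

twoStarSets-proper : {m₁ m₂ w : ℕ} (C₁ : Fin m₁ → Subset w) (C₂ : Fin m₂ → Subset w) (a b : Fin w)
  (u v : Fin (suc m₁ + suc m₂)) {x y : Fin w} →
  x ∈ twoStarSets C₁ C₂ a b (splitAt (suc m₁) u) → y ∈ twoStarSets C₁ C₂ a b (splitAt (suc m₁) v) →
  UnionAdj m₁ m₂ u v → x ≢ y
twoStarSets-proper {m₁} C₁ C₂ a b u v x∈ y∈ adj with splitAt (suc m₁) u | splitAt (suc m₁) v
... | inj₁ _ | inj₁ _ = starSets-proper C₁ a x∈ y∈ adj
... | inj₂ _ | inj₂ _ = starSets-proper C₂ b x∈ y∈ adj

choice-equitable : (w ρ : ℕ) (L : ListAssignment n) (S : Fin n → Subset w) →
  (∀ {c} → c List.∈ palette L → c < w) → ((g , _) : Choice S (replicate w ρ)) →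
  ∀ c → c List.∈ palette L → colorCount (toℕ ∘ g) c ≤ ρ
choice-equitable {n} w ρ L S bounded (g , _ , limited) c c∈ = begin
  colorCount (toℕ ∘ g) c              ≡⟨ length-filter-tabulate (λ v → toℕ (g v) ≟ c) id ⟩
  count (λ v → toℕ (g v) ≟ c)
    ≤⟨ count-mono (λ v → toℕ (g v) ≟ c) (λ v → g v Fin.≟ j)
         (λ v eq → toℕ-injective (trans eq (sym (toℕ-fromℕ< (bounded c∈))))) ⟩
  count (λ v → g v Fin.≟ j)           ≤⟨ limited j ⟩
  lookup (replicate w ρ) j            ≡⟨ lookup-replicate j ρ ⟩
  ρ                                   ∎
  where
  open ≤-Reasoning
  j : Fin w
  j = fromℕ< (bounded c∈)

-- Arithmetic

-- The ceiling is the integer quotient of `a + κ`, whose remainder is at most `κ`.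
≤⌈/⌉* : ∀ a κ → a ≤ ⌈ a / suc κ ⌉ * suc κ
≤⌈/⌉* a κ = +-cancelʳ-≤ κ a _ (begin
  a + κ                                             ≡⟨ m≡m%n+[m/n]*n (a + κ) (suc κ) ⟩
  (a + κ) % suc κ + ⌈ a / suc κ ⌉ * suc κ           ≤⟨ +-monoˡ-≤ _ (≤-pred (m%n<n (a + κ) (suc κ))) ⟩
  κ + ⌈ a / suc κ ⌉ * suc κ                         ≡⟨ +-comm κ _ ⟩
  ⌈ a / suc κ ⌉ * suc κ + κ                         ∎)
  where open ≤-Reasoning

-- With `r` for `ρ` and `p` for `ρ * κ`, adding the premises gives 2N ≤ 13 + 2p, and parity rounds
-- 13 down to 12. This is where the constant 15 enters.
averaging : ∀ N r p → N + 2 ≤ r + p → N + r * 2 ≤ 15 + (r + p) → N ≤ 6 + p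
averaging N r p N≤₁ N≤₂ = ≮⇒≥ (λ large → contradiction (begin-strict
  15 + (r + p) + (r + p)            <⟨ n<1+n _ ⟩
  16 + (r + p) + (r + p)            ≡⟨ regroup₁ r p ⟩
  (7 + p) + (7 + p) + (r * 2 + 2)   ≤⟨ +-monoˡ-≤ _ (+-mono-≤ large large) ⟩
  N + N + (r * 2 + 2)               ≡⟨ regroup₂ N r ⟩
  (N + r * 2) + (N + 2)             ≤⟨ +-mono-≤ N≤₂ N≤₁ ⟩
  15 + (r + p) + (r + p)            ∎) (n≮n _))
  where
  open ≤-Reasoning
  regroup₁ : ∀ r p → 16 + (r + p) + (r + p) ≡ (7 + p) + (7 + p) + (r * 2 + 2)
  regroup₁ = solve-∀
  regroup₂ : ∀ N r → N + N + (r * 2 + 2) ≡ (N + r * 2) + (N + 2)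
  regroup₂ = solve-∀

-- From the numerical hypotheses to an equitable colouring

theorem1p7 : (k m₁ m₂ : ℕ) → (k≥1 : 1 ≤ k) → 1 ≤ m₁ → m₁ ≤ m₂ →
    let instance _ = ≢0-of k≥1 in
    let ρ = ⌈ m₁ + m₂ + 2 / k ⌉ in
    m₂ + 1 ≤ ρ * (k ∸ 1) → m₁ + m₂ + ρ * 2 ≤ 15 + ρ * k →
    EquitablyChoosable (TwoStars m₁ m₂) k
theorem1p7 (suc κ) m₁ m₂ k≥1 _ m₁≤m₂ m₂+1≤ excess L kL =
  build (two-colours (proj₁ (kL (vertex (inj₁ zero)))) (2≤length _) (list-bounded _))
        (two-colours (proj₁ (kL (vertex (inj₂ zero)))) (2≤length _) (list-bounded _))
  where
  ρ bound : ℕ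
  ρ = ⌈ m₁ + m₂ + 2 / suc κ ⌉
  bound = suc (max 0 (palette L))

  vertex : Fin (suc m₁) ⊎ Fin (suc m₂) → Fin (suc m₁ + suc m₂)
  vertex = join (suc m₁) (suc m₂)

  order : m₁ + m₂ + 2 ≡ suc m₁ + suc m₂
  order = rearrange m₁ m₂
    where
    rearrange : ∀ m n → m + n + 2 ≡ suc m + suc n
    rearrange = solve-∀

  m₂< : m₂ < ρ * κ
  m₂< = subst (_≤ ρ * κ) (+-comm m₂ 1) m₂+1≤

  -- `m₂ < ρ * κ` fails for `κ` equal to 0, so every list, in particular that of a centre, offers
  -- two colours.
  1≤κ : 1 ≤ κ
  1≤κ = *-cancelˡ-< ρ 0 κ (subst (_< ρ * κ) (sym (*-zeroʳ ρ)) (≤-trans (s≤s z≤n) m₂<))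

  fits : m₁ + m₂ + 2 ≤ ρ * suc κ
  fits = ≤⌈/⌉* (m₁ + m₂ + 2) κ

  few : m₁ + m₂ ≤ 6 + ρ * κ
  few = averaging (m₁ + m₂) ρ (ρ * κ)
    (subst (m₁ + m₂ + 2 ≤_) (*-suc ρ κ) fits)
    (subst (λ t → m₁ + m₂ + ρ * 2 ≤ 15 + t) (*-suc ρ κ) excess)

  list-bounded : ∀ v → All (_< bound) (L v)
  list-bounded v = All.tabulate (λ c∈ → palette-bounded L (∈-palette L v c∈))

  2≤length : ∀ v → 2 ≤ length (L v)
  2≤length v = ≤-trans (s≤s 1≤κ) (≤-reflexive (sym (proj₂ (kL v))))

  C : Fin (suc m₁) ⊎ Fin (suc m₂) → Subset bound
  C s = colours bound (L (vertex s))

  large : ∀ s → suc κ ≤ ∣ C s ∣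
  large s = ≤-trans (≤-reflexive (sym (proj₂ (kL (vertex s)))))
                    (length≤∣colours∣ (proj₁ (kL (vertex s))) (list-bounded (vertex s)))

  C₁ : Fin m₁ → Subset bound
  C₁ i = C (inj₁ (suc i))
  C₂ : Fin m₂ → Subset bound
  C₂ i = C (inj₂ (suc i))

  sets⊆lists : ∀ {x y} → toℕ x List.∈ L (vertex (inj₁ zero)) → toℕ y List.∈ L (vertex (inj₂ zero)) →
    ∀ s {c} → c ∈ twoStarSets C₁ C₂ x y s → toℕ c List.∈ L (vertex s)
  sets⊆lists {x} x∈ y∈ (inj₁ zero) c∈ with refl ← x∈⁅y⁆⇒x≡y x c∈ = x∈
  sets⊆lists {y = y} x∈ y∈ (inj₂ zero) c∈ with refl ← x∈⁅y⁆⇒x≡y y c∈ = y∈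
  sets⊆lists {x} x∈ y∈ (inj₁ (suc i)) c∈ = ∈-colours⁻ _ (p─q⊆p (C₁ i) ⁅ x ⁆ c∈)
  sets⊆lists {y = y} x∈ y∈ (inj₂ (suc i)) c∈ = ∈-colours⁻ _ (p─q⊆p (C₂ i) ⁅ y ⁆ c∈)

  Member² : Fin (suc m₁ + suc m₂) → Set
  Member² v = ∃₂ λ (a a′ : Fin bound) → a ≢ a′ × toℕ a List.∈ L v × toℕ a′ List.∈ L v

  build : Member² (vertex (inj₁ zero)) → Member² (vertex (inj₂ zero)) →
    Σ (Fin (suc m₁ + suc m₂) → ℕ) (IsEquitableLColoring (TwoStars m₁ m₂) (suc κ) L)
  build (a , a′ , a≢a′ , a∈ , a′∈) (b , b′ , b≢b′ , b∈ , b′∈)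
    with colour-two-stars C₁ C₂ (large ∘ inj₁ ∘ suc) (large ∘ inj₂ ∘ suc)
           (subst (_≤ ρ * suc κ) order fits) (≤-trans (s≤s m₁≤m₂) m₂<) m₂< few a≢a′ b≢b′
  ... | x , y , x≡ , y≡ , choice@(g , g∈ , _) =
    toℕ ∘ g , (listed , proper) ,
    -- The graph has `suc m₁ + suc m₂` vertices while `ρ` is formed from `m₁ + m₂ + 2`; `order`
    -- reconciles the two.
    subst (λ t → ∀ c → c List.∈ palette L → colorCount (toℕ ∘ g) c ≤ ⌈ t / suc κ ⌉) order
          (choice-equitable bound ρ L _ (palette-bounded L) choice)
    where
    x∈ : toℕ x List.∈ L (vertex (inj₁ zero))
    x∈ = [ (λ { refl → a∈ }) , (λ { refl → a′∈ }) ]′ x≡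
    y∈ : toℕ y List.∈ L (vertex (inj₂ zero))
    y∈ = [ (λ { refl → b∈ }) , (λ { refl → b′∈ }) ]′ y≡
    listed : ∀ v → toℕ (g v) List.∈ L v
    listed v = subst (λ u → toℕ (g v) List.∈ L u) (join-splitAt (suc m₁) (suc m₂) v)
                     (sets⊆lists x∈ y∈ (splitAt (suc m₁) v) (g∈ v))
    proper : ∀ u v → UnionAdj m₁ m₂ u v → ¬ toℕ (g u) ≡ toℕ (g v)
    proper u v adj eq = twoStarSets-proper C₁ C₂ x y u v (g∈ u) (g∈ v) adj (toℕ-injective eq)
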